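{- For all nonnegative integers $k,d,i,j$ with $k>0$, $$F_{\,kd+id+j(i+1)(2(k-1)d+1),\;d+j(2(k-1)d+1)}=1.$$
   Context: Define maps $G,S:\mathbb Z^2\to\mathbb Z^2$ by $G(x,y)=(x+y,y)$ and $S(x,y)=(3x-2y+1,\,2x-y+1)$. Define the array $(F_{n,k})_{n,k\ge 0}$ by $F_{0,0}=1$ and, for $(n,k)\neq(0,0)$, $F_{n,k}$ is the number of finite words $w=w_1w_2\cdots w_m$ ($m\ge 0$) over the alphabet $\{G,S\}$ with $w_1\circ w_2\circ\cdots\circ w_m(1,1)=(n,k)$ (the empty word acts as the identity). Equivalently: start with all entries $0$, set $F_{0,0}=1$ and $F_{1,1}=1$, and thereafter, whenever an entry $F_{n,k}$ with $n\ge 1$ changes its value, increase $F_{n+k,k}$ and $F_{3n+1-2k,\,2n+1-k}$ by $1$. -}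

module Defs where

open import Axiom.UniquenessOfIdentityProofs using (module Decidable⇒UIP)
open import Data.Empty using (⊥-elim)
open import Data.Fin.Base using (Fin; zero; suc)
open import Data.Integer.Base as ℤ using (ℤ; +_)
import Data.Integer.Properties as ℤ
open import Data.Integer.Tactic.RingSolver using (solve-∀)
open import Data.List.Base using (List; []; _∷_; length; lookup; filter; foldr; cartesianProductWith)
open import Data.List.Membership.Propositional using (_∈_)
open import Data.List.Membership.Propositional.Properties
  using (∈-filter⁺; ∈-filter⁻; ∈-cartesianProductWith⁺; ∈-cartesianProductWith⁻; ∈-lookup)
open import Data.List.Properties using (∷-injective)
open import Data.List.Relation.Unary.All as All using ([]; _∷_)
open import Data.List.Relation.Unary.AllPairs using ([]; _∷_)
open import Data.List.Relation.Unary.Any as Any using (here; there)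
open import Data.List.Relation.Unary.Any.Properties using (lookup-index)
open import Data.List.Relation.Unary.Unique.Propositional using (Unique)
open import Data.List.Relation.Unary.Unique.Propositional.Properties
  using (filter⁺; cartesianProductWith⁺)
open import Data.Nat.Base using (ℕ; zero; suc; _+_; _≤_; z≤n; s≤s)
import Data.Nat.Properties as ℕ
open import Data.Product.Base using (∃; ∃₂; _×_; _,_; proj₁; proj₂)
open import Data.Product.Properties using (≡-dec)
open import Function.Bundles using (_↔_; mk↔ₛ′)
open import Relation.Binary.Definitions using (DecidableEquality)
open import Relation.Binary.PropositionalEquality
  using (_≡_; _≢_; refl; sym; trans; cong; cong₂; subst)

ℤ² : Set
ℤ² = ℤ × ℤ

infix 4 _≟_
_≟_ : DecidableEquality ℤ²
_≟_ = ≡-dec ℤ._≟_ ℤ._≟_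

data Letter : Set where
  G S : Letter

Word : Set
Word = List Letter

act : Letter → ℤ² → ℤ²
act G (x , y) = x ℤ.+ y , y
act S (x , y) = + 3 ℤ.* x ℤ.- + 2 ℤ.* y ℤ.+ + 1 , + 2 ℤ.* x ℤ.- y ℤ.+ + 1

⟦_⟧ : Word → ℤ² → ℤ²
⟦ w ⟧ p = foldr act p w

start : ℤ²
start = + 1 , + 1

wordsUpTo : ℕ → List Word
wordsUpTo zero    = [] ∷ []
wordsUpTo (suc m) = [] ∷ cartesianProductWith _∷_ (G ∷ S ∷ []) (wordsUpTo m)

-- Both maps strictly increase the first coordinate along the orbit of (1,1), so
-- a word taking (1,1) to (n,k) has length less than n.  `F-counts` below shows
-- that restricting to length at most n therefore loses nothing.
wordsTo : ℕ → ℕ → List Word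
wordsTo n k = filter (λ w → ⟦ w ⟧ start ≟ (+ n , + k)) (wordsUpTo n)

F : ℕ → ℕ → ℕ
F zero zero = 1
F n    k    = length (wordsTo n k)

wordsUpTo-unique : ∀ m → Unique (wordsUpTo m)
wordsUpTo-unique zero    = [] ∷ []
wordsUpTo-unique (suc m) =
  All.tabulate []∉ ∷ cartesianProductWith⁺ _∷_ ∷-injective GS! (wordsUpTo-unique m)
  where
  GS! : Unique (G ∷ S ∷ [])
  GS! = ((λ ()) ∷ []) ∷ [] ∷ []

  []∉ : ∀ {w} → w ∈ cartesianProductWith _∷_ (G ∷ S ∷ []) (wordsUpTo m) → [] ≢ w
  []∉ w∈ refl with ∈-cartesianProductWith⁻ _∷_ (G ∷ S ∷ []) (wordsUpTo m) w∈
  ... | _ , _ , _ , _ , ()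

wordsUpTo-complete : ∀ {m} w → length w ≤ m → w ∈ wordsUpTo m
wordsUpTo-complete {zero}  []      _         = here refl
wordsUpTo-complete {suc m} []      _         = here refl
wordsUpTo-complete {suc m} (a ∷ w) (s≤s ∣w∣≤m) =
  there (∈-cartesianProductWith⁺ _∷_ (letter∈ a) (wordsUpTo-complete w ∣w∣≤m))
  where
  letter∈ : ∀ a → a ∈ G ∷ S ∷ []
  letter∈ G = here refl
  letter∈ S = there (here refl)

orbit : ∀ w → ∃₂ λ b e →
        ⟦ w ⟧ start ≡ (+ suc (b + e) , + suc b) × length w ≤ b + e
orbit [] = 0 , 0 , refl , z≤n
orbit (G ∷ w) with orbit w
... | b , e , eq , ∣w∣≤ =
  b , e + suc b , trans (cong (act G) eq) (cong (λ t → + suc t , + suc b) (ℕ.+-assoc b e (suc b))) ,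
  ℕ.≤-trans (s≤s ∣w∣≤) (ℕ.≤-trans (ℕ.≤-reflexive (sym (ℕ.+-suc b e)))
    (ℕ.+-monoʳ-≤ b (ℕ.≤-trans (ℕ.m≤m+n (suc e) b) (ℕ.≤-reflexive (sym (ℕ.+-suc e b))))))
orbit (S ∷ w) with orbit w
... | b , e , eq , ∣w∣≤ =
  suc (b + (e + e)) , e ,
  trans (cong (act S) eq) (cong₂ _,_ (first (+ b) (+ e)) (second (+ b) (+ e))) ,
  s≤s (ℕ.≤-trans ∣w∣≤ (ℕ.+-monoˡ-≤ e (ℕ.m≤m+n b (e + e))))
  where
  first : ∀ b e → + 3 ℤ.* (+ 1 ℤ.+ (b ℤ.+ e)) ℤ.- + 2 ℤ.* (+ 1 ℤ.+ b) ℤ.+ + 1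
                  ≡ + 1 ℤ.+ (+ 1 ℤ.+ (b ℤ.+ (e ℤ.+ e)) ℤ.+ e)
  first = solve-∀

  second : ∀ b e → + 2 ℤ.* (+ 1 ℤ.+ (b ℤ.+ e)) ℤ.- (+ 1 ℤ.+ b) ℤ.+ + 1
                   ≡ + 1 ℤ.+ (+ 1 ℤ.+ (b ℤ.+ (e ℤ.+ e)))
  second = solve-∀

length≤ : ∀ {n k} w → ⟦ w ⟧ start ≡ (+ n , + k) → length w ≤ n
length≤ w p with orbit w
... | b , e , eq , ∣w∣≤ =
  subst (length w ≤_) (ℤ.+-injective (cong proj₁ (trans (sym eq) p))) (ℕ.m≤n⇒m≤1+n ∣w∣≤)

lookup-injective : ∀ {A : Set} {xs : List A} → Unique xs →
                   ∀ i j → lookup xs i ≡ lookup xs j → i ≡ j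
lookup-injective (_ ∷ _)    zero    zero    _  = refl
lookup-injective (x∉ ∷ _)   zero    (suc j) eq = ⊥-elim (All.lookup x∉ (∈-lookup j) eq)
lookup-injective (x∉ ∷ _)   (suc i) zero    eq = ⊥-elim (All.lookup x∉ (∈-lookup i) (sym eq))
lookup-injective (_ ∷ xs!)  (suc i) (suc j) eq = cong suc (lookup-injective xs! i j eq)

wordsTo-counts : ∀ n k → Fin (length (wordsTo n k)) ↔ ∃ λ w → ⟦ w ⟧ start ≡ (+ n , + k)
wordsTo-counts n k = mk↔ₛ′ to from to-from from-to
  where
  hits? = λ w → ⟦ w ⟧ start ≟ (+ n , + k)

  Hits : Set
  Hits = ∃ λ w → ⟦ w ⟧ start ≡ (+ n , + k)

  to : Fin (length (wordsTo n k)) → Hits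
  to i = lookup (wordsTo n k) i , proj₂ (∈-filter⁻ hits? {xs = wordsUpTo n} (∈-lookup i))

  member : (h : Hits) → proj₁ h ∈ wordsTo n k
  member (w , p) = ∈-filter⁺ hits? (wordsUpTo-complete w (length≤ w p)) p

  from : Hits → Fin (length (wordsTo n k))
  from h = Any.index (member h)

  Hits-≡ : {g h : Hits} → proj₁ g ≡ proj₁ h → g ≡ h
  Hits-≡ {w , p} {_ , q} refl = cong (w ,_) (Decidable⇒UIP.≡-irrelevant _≟_ p q)

  to-from : ∀ h → to (from h) ≡ h
  to-from h = Hits-≡ (sym (lookup-index (member h)))

  from-to : ∀ i → from (to i) ≡ i
  from-to i = lookup-injective (filter⁺ hits? (wordsUpTo-unique n)) _ _ (cong proj₁ (to-from (to i)))

F-counts : ∀ n k → (n , k) ≢ (0 , 0) → Fin (F n k) ↔ ∃ λ w → ⟦ w ⟧ start ≡ (+ n , + k)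
F-counts zero    zero    ≢0 = ⊥-elim (≢0 refl)
F-counts zero    (suc k) _  = wordsTo-counts zero (suc k)
F-counts (suc n) k       _  = wordsTo-counts (suc n) k

{-# OPTIONS --safe #-}

-- In the coordinates (b , e) with (n , k) = (1 + b + e , 1 + b), the start is
-- (0 , 0), G is (b , e) ↦ (b , e + b + 1) and S is (b , e) ↦ (b + 2e + 1 , e).
-- The image of G lies in b < e and the image of S in e < b, so every point
-- other than the start determines the letter last applied, and no point is
-- reached twice.  The entry in question is reached by Gⁱ Sʲ Gᵏ⁻¹ Sᵈ⁻¹, or by
-- Gⁱ Sʲ⁻¹ when d = 0.
module Submission where

open import Defs
open import Axiom.UniquenessOfIdentityProofs using (module Decidable⇒UIP)
open import Data.Fin.Base using (Fin; zero; suc)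
open import Data.Integer.Base as ℤ using (+_)
import Data.Integer.Properties as ℤ
import Data.Integer.Tactic.RingSolver as ℤ-Solver
open import Data.List.Base using ([]; _∷_; foldr)
open import Data.Nat.Base using (ℕ; zero; suc; _+_; _*_; _∸_; _>_; _<_)
open import Data.Nat.Properties hiding (_≟_)
open import Data.Nat.Tactic.RingSolver using (solve-∀)
open import Data.Product.Base using (∃; _×_; _,_; proj₁; proj₂)
open import Function.Bundles using (_↔_; module Inverse)
open import Relation.Binary.PropositionalEquality
  using (_≡_; _≢_; refl; sym; trans; cong; cong₂; subst)
open import Relation.Nullary.Negation using (contradiction)

step : Letter → ℕ × ℕ → ℕ × ℕ
step G (b , e) = b , e + suc b
step S (b , e) = b + suc (e + e) , e

trace : Word → ℕ × ℕ
trace = foldr step (0 , 0)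

embed : ℕ × ℕ → ℤ²
embed (b , e) = + suc (b + e) , + suc b

act-embed : ∀ a p → act a (embed p) ≡ embed (step a p)
act-embed G (b , e) = cong (λ t → + suc t , + suc b) (+-assoc b e (suc b))
-- `S` involves subtraction, so its identities are solved over ℤ; at `+ b` and `+ e` both sides
-- compute to the required form.
act-embed S (b , e) = cong₂ _,_ (first (+ b) (+ e)) (second (+ b) (+ e))
  where
  first : ∀ b e → + 3 ℤ.* (+ 1 ℤ.+ (b ℤ.+ e)) ℤ.- + 2 ℤ.* (+ 1 ℤ.+ b) ℤ.+ + 1
                  ≡ + 1 ℤ.+ (b ℤ.+ (+ 1 ℤ.+ (e ℤ.+ e)) ℤ.+ e)
  first = ℤ-Solver.solve-∀

  second : ∀ b e → + 2 ℤ.* (+ 1 ℤ.+ (b ℤ.+ e)) ℤ.- (+ 1 ℤ.+ b) ℤ.+ + 1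
                   ≡ + 1 ℤ.+ (b ℤ.+ (+ 1 ℤ.+ (e ℤ.+ e)))
  second = ℤ-Solver.solve-∀

⟦⟧-trace : ∀ w → ⟦ w ⟧ start ≡ embed (trace w)
⟦⟧-trace []      = refl
⟦⟧-trace (a ∷ w) = trans (cong (act a) (⟦⟧-trace w)) (act-embed a (trace w))

embed-injective : ∀ {p q} → embed p ≡ embed q → p ≡ q
embed-injective {b , e} {b′ , e′} eq
  with refl ← suc-injective (ℤ.+-injective (cong proj₂ eq))
  = cong (b ,_) (+-cancelˡ-≡ b e e′ (suc-injective (ℤ.+-injective (cong proj₁ eq))))

step-injective : ∀ a {p q} → step a p ≡ step a q → p ≡ q
step-injective G {b , e} {_ , e′} eq with refl ← cong proj₁ eq =
  cong (b ,_) (+-cancelʳ-≡ (suc b) e e′ (cong proj₂ eq))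
step-injective S {b , e} {b′ , _} eq with refl ← cong proj₂ eq =
  cong (_, e) (+-cancelʳ-≡ (suc (e + e)) b b′ (cong proj₁ eq))

step-G-< : ∀ p → proj₁ (step G p) < proj₂ (step G p)
step-G-< (b , e) = m≤n+m (suc b) e

step-S-> : ∀ p → proj₁ (step S p) > proj₂ (step S p)
step-S-> (b , e) = m≤n⇒m≤o+n b (m≤m+n (suc e) e)

stepG≢stepS : ∀ p q → step G p ≢ step S q
stepG≢stepS p q eq =
  <-asym (step-S-> q) (subst (λ r → proj₁ r < proj₂ r) eq (step-G-< p))

-- The origin lies on the diagonal b = e, which both images avoid.
origin≢step : ∀ a p → (0 , 0) ≢ step a p
origin≢step G p eq = n≮n 0 (subst (λ r → proj₁ r < proj₂ r) (sym eq) (step-G-< p))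
origin≢step S p eq = n≮n 0 (subst (λ r → proj₁ r > proj₂ r) (sym eq) (step-S-> p))

trace-injective : ∀ u v → trace u ≡ trace v → u ≡ v
trace-injective []      []      _  = refl
trace-injective []      (a ∷ v) eq = contradiction eq (origin≢step a (trace v))
trace-injective (a ∷ u) []      eq = contradiction (sym eq) (origin≢step a (trace u))
trace-injective (G ∷ u) (G ∷ v) eq = cong (G ∷_) (trace-injective u v (step-injective G eq))
trace-injective (G ∷ u) (S ∷ v) eq = contradiction eq (stepG≢stepS (trace u) (trace v))
trace-injective (S ∷ u) (G ∷ v) eq = contradiction (sym eq) (stepG≢stepS (trace v) (trace u))
trace-injective (S ∷ u) (S ∷ v) eq = cong (S ∷_) (trace-injective u v (step-injective S eq))

⟦⟧start-injective : ∀ u v → ⟦ u ⟧ start ≡ ⟦ v ⟧ start → u ≡ v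
⟦⟧start-injective u v eq = trace-injective u v
  (embed-injective (trans (sym (⟦⟧-trace u)) (trans eq (⟦⟧-trace v))))

-- Turns existence and uniqueness of a word into the value of an entry of `F`. Every index equals
-- the preimage of `x`, so there cannot be two.
Fin↔contractible⇒≡1 : ∀ {n} {A : Set} → Fin n ↔ A → (x : A) → (∀ y → x ≡ y) → n ≡ 1
Fin↔contractible⇒≡1 {zero} f x _ with Inverse.from f x
... | ()
Fin↔contractible⇒≡1 {suc zero} _ _ _ = refl
Fin↔contractible⇒≡1 {suc (suc n)} f x x≡ =
  contradiction (trans (sym (from≡ zero)) (from≡ (suc zero))) λ ()
  where
  from≡ : ∀ i → Inverse.from f x ≡ i
  from≡ i = trans (cong (Inverse.from f) (x≡ _)) (Inverse.strictlyInverseʳ f i)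

Reached : ℕ → ℕ → Set
Reached b e = ∃ λ w → trace w ≡ (b , e)

-- One word suffices, as injectivity excludes any other. Taking the indices up to equality leaves
-- only polynomial identities to check.
F-reached : ∀ {b e n k} → Reached b e → n ≡ suc (b + e) → k ≡ suc b → F n k ≡ 1
F-reached {b} {e} (w , eq) refl refl =
  Fin↔contractible⇒≡1 (F-counts _ _ λ ()) (w , hit) unique
  where
  hit : ⟦ w ⟧ start ≡ (+ suc (b + e) , + suc b)
  hit = trans (⟦⟧-trace w) (cong embed eq)

  unique : ∀ h → (w , hit) ≡ h
  unique (v , p) with refl ← ⟦⟧start-injective w v (trans hit (sym p)) =
    -- The words now agree; the two equality proofs agree because equality on `ℤ²` is decidable.
    cong (w ,_) (Decidable⇒UIP.≡-irrelevant _≟_ hit p)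

reached-origin : Reached 0 0
reached-origin = [] , refl

-- `G` fixes b, so its increment `suc b` is the same at each iteration.
reached-Gⁱ : ∀ i {b e} → Reached b e → Reached b (i * suc b + e)
reached-Gⁱ zero    r = r
reached-Gⁱ (suc i) {b} {e} r with w , eq ← reached-Gⁱ i r =
  G ∷ w , trans (cong (step G) eq) (cong (b ,_)
    (trans (+-comm (i * suc b + e) (suc b)) (sym (+-assoc (suc b) (i * suc b) e))))

-- Dually, `S` fixes e and with it the increment 2e + 1.
reached-Sʲ : ∀ j {b e} → Reached b e → Reached (j * suc (e + e) + b) e
reached-Sʲ zero    r = r
reached-Sʲ (suc j) {b} {e} r with w , eq ← reached-Sʲ j r =
  S ∷ w , trans (cong (step S) eq) (cong (_, e)
    (trans (+-comm (j * suc (e + e) + b) (suc (e + e)))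
           (sym (+-assoc (suc (e + e)) (j * suc (e + e)) b))))

reached-Sᵈ-origin : ∀ d → Reached d 0
reached-Sᵈ-origin d = subst (λ b → Reached b 0)
  (trans (+-identityʳ (d * 1)) (*-identityʳ d)) (reached-Sʲ d reached-origin)

-- The row index D + jM is kept as a block, so that it can later be replaced by `suc b`. The
-- identity holds for arbitrary M; the `+ 0` matches the e that `reached-Gⁱ` yields from e = 0.
column-via-row : ∀ k D i j M →
  suc k * D + i * D + j * (i + 1) * M ≡ (D + j * M) + (i * (D + j * M) + (k * D + 0))
column-via-row = solve-∀

theorem14 : ∀ (k d i j : ℕ) → k > 0 →
    F (k * d + i * d + j * (i + 1) * (2 * (k ∸ 1) * d + 1))
    (d + j * (2 * (k ∸ 1) * d + 1)) ≡ 1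
-- This is the entry at (0 , 0), which is 1 by definition.
theorem14 (suc k) zero i zero _ rewrite *-zeroʳ k | *-zeroʳ i = refl
-- For d = 0 the factor 2(k-1)d + 1 is 1, so the row index is `suc j` and b = j.
theorem14 (suc k) zero i (suc j) _ =
  F-reached (reached-Gⁱ i (reached-Sᵈ-origin j)) (column k i j) (row k j)
  where
  column : ∀ k i j → suc k * 0 + i * 0 + suc j * (i + 1) * (2 * k * 0 + 1)
                     ≡ suc (j + (i * suc j + 0))
  column = solve-∀

  row : ∀ k j → suc j * (2 * k * 0 + 1) ≡ suc j
  row = solve-∀
theorem14 (suc k) (suc d) i j _ =
  -- From (d , 0), k steps `G` give e = k(d + 1); each later `S` then adds 2e + 1, which is exactly
  -- `M`.
  F-reached (reached-Gⁱ i (reached-Sʲ j (reached-Gⁱ k (reached-Sᵈ-origin d)))) column row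
  where
  M b e : ℕ
  M = 2 * k * suc d + 1
  e = k * suc d + 0
  b = j * suc (e + e) + d

  row-expanded : ∀ k d j →
    suc d + j * (2 * k * suc d + 1)
    ≡ suc (j * suc ((k * suc d + 0) + (k * suc d + 0)) + d)
  row-expanded = solve-∀

  row : suc d + j * M ≡ suc b
  row = row-expanded k d j

  column : suc k * suc d + i * suc d + j * (i + 1) * M ≡ suc (b + (i * suc b + e))
  column = trans (column-via-row k (suc d) i j M) (cong (λ y → y + (i * y + e)) row)
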